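{- For every function $f\colon\{0,1\}^n\to\{0,1\}$ and every probability distribution $\mu$ over $\{0,1\}^n$, $$\max_{S\in\mathcal{O}_n}\mathsf{bias}(f,\mu,S)\;\le\;\max_{S\in\mathcal{S}_n}\mathsf{bias}(f,\mu,S)\;\le\;\|\widehat{F_\mu}\|_\infty\;\le\;2\cdot\max_{S\in\mathcal{O}_n}\mathsf{bias}(f,\mu,S).$$
   Context: $n\ge 1$. $\mathcal{S}_n$ is the set of all affine subspaces of $\{0,1\}^n=\mathbb{F}_2^n$ and $\mathcal{O}_n\subseteq\mathcal{S}_n$ is the set of affine subspaces of codimension $1$. $\mathsf{bias}(f,\mu,S)=\left|\sum_{x\in S}(-1)^{f(x)}\mu(x)\right|$. $F_\mu\colon\{0,1\}^n\to\mathbb{R}$ is $F_\mu(x)=(-1)^{f(x)}\cdot\mu(x)\cdot 2^n$. The Fourier transform of $F\colon\{0,1\}^n\to\mathbb{R}$ is $\widehat F(z)=2^{ -n}\sum_{x\in\{0,1\}^n}F(x)(-1)^{\langle x,z\rangle}$ with $\langle x,z\rangle=\sum_i x_iz_i\bmod 2$, and $\|\widehat F\|_\infty=\max_{z}|\widehat F(z)|$. -}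

module Defs where

open import Data.Bool.Base using (Bool; true; false; _∧_; _xor_; if_then_else_; T)
open import Data.Bool.Properties using (T?; xor-same; xor-assoc)
import Data.Bool.Properties as Bool
open import Data.Integer.Base using (+_)
open import Data.List.Base using (List; []; _∷_; foldr; filter; filterᵇ; cartesianProductWith)
open import Data.List.Membership.Propositional using (_∈_; lose; find)
open import Data.List.Membership.Propositional.Properties using (∈-cartesianProductWith⁺)
open import Data.List.Relation.Unary.All as All using (all?)
open import Data.List.Relation.Unary.Any using (here; there; any?)
open import Data.Nat.Base as ℕ using (ℕ; zero; suc)
import Data.Nat.Properties as ℕ
open import Data.Product using (_×_; _,_; ∃; ∃-syntax; map₂; proj₁; proj₂)
open import Data.Rational.Base as ℚ using (ℚ; 0ℚ; 1ℚ; ½)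
import Data.Rational.Properties as ℚ
open import Data.Rational.Solver using (module +-*-Solver)
open import Data.Sum.Base using (inj₁; inj₂)
open import Data.Vec.Base as Vec using (Vec; []; _∷_; zipWith; replicate)
open import Data.Vec.Properties using (≡-dec)
open import Function.Base using (_∘_)
open import Relation.Binary.PropositionalEquality
  using (_≡_; _≗_; refl; sym; trans; cong; cong₂; subst; subst₂)
open import Relation.Nullary.Decidable using (Dec; yes; no; map′; _×-dec_; _→-dec_)
open import Relation.Unary using (Decidable)

-- Equality of these Cauchy reals is the relation _≃_ below, not _≡_.

IsCauchy : (ℕ → ℚ) → Set
IsCauchy s = ∀ ε → 0ℚ ℚ.< ε →
  ∃[ N ] ∀ i j → N ℕ.≤ i → N ℕ.≤ j → ℚ.∣ s i ℚ.- s j ∣ ℚ.≤ ε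

record ℝ : Set where
  constructor mkℝ
  field
    seq    : ℕ → ℚ
    cauchy : IsCauchy seq

open ℝ public

infix 4 _≤_ _≃_

_≤_ : ℝ → ℝ → Set
x ≤ y = ∀ ε → 0ℚ ℚ.< ε →
  ∃[ N ] ∀ i → N ℕ.≤ i → seq x i ℚ.≤ seq y i ℚ.+ ε

_≃_ : ℝ → ℝ → Set
x ≃ y = x ≤ y × y ≤ x

private
  ½ε+½ε : ∀ ε → ½ ℚ.* ε ℚ.+ ½ ℚ.* ε ≡ ε
  ½ε+½ε ε = trans (sym (ℚ.*-distribʳ-+ ε ½ ½)) (ℚ.*-identityˡ ε)

  *-pos : ∀ {p q} → 0ℚ ℚ.< p → 0ℚ ℚ.< q → 0ℚ ℚ.< p ℚ.* q
  *-pos {p} {q} 0<p 0<q = ℚ.positive⁻¹ (p ℚ.* q)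
    {{ℚ.pos*pos⇒pos p {{ℚ.positive 0<p}} q {{ℚ.positive 0<q}}}}

  ½ε>0 : ∀ {ε} → 0ℚ ℚ.< ε → 0ℚ ℚ.< ½ ℚ.* ε
  ½ε>0 = *-pos (ℚ.positive⁻¹ ½)

  p≤∣p∣ : ∀ p → p ℚ.≤ ℚ.∣ p ∣
  p≤∣p∣ p with ℚ.≤-total 0ℚ p
  ... | inj₁ 0≤p = ℚ.≤-reflexive (sym (ℚ.0≤p⇒∣p∣≡p 0≤p))
  ... | inj₂ p≤0 = ℚ.≤-trans p≤0 (ℚ.0≤∣p∣ p)

  ∣-∣-sym : ∀ p q → ℚ.∣ p ℚ.- q ∣ ≡ ℚ.∣ q ℚ.- p ∣
  ∣-∣-sym p q = trans (cong ℚ.∣_∣ lem) (ℚ.∣-p∣≡∣p∣ (q ℚ.- p))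
    where
    open +-*-Solver
    lem : p ℚ.- q ≡ ℚ.- (q ℚ.- p)
    lem = solve 2 (λ p q → p :- q := :- (q :- p)) refl p q

  close⇒≤ : ∀ p q {ε} → ℚ.∣ p ℚ.- q ∣ ℚ.≤ ε → p ℚ.≤ q ℚ.+ ε
  close⇒≤ p q {ε} h = subst (ℚ._≤ q ℚ.+ ε) lem
    (ℚ.+-monoʳ-≤ q (ℚ.≤-trans (p≤∣p∣ (p ℚ.- q)) h))
    where
    open +-*-Solver
    lem : q ℚ.+ (p ℚ.- q) ≡ p
    lem = solve 2 (λ p q → q :+ (p :- q) := p) refl p q

  close⇒≥ : ∀ p q {ε} → ℚ.∣ p ℚ.- q ∣ ℚ.≤ ε → q ℚ.≤ p ℚ.+ ε
  close⇒≥ p q {ε} h = close⇒≤ q p (subst (ℚ._≤ ε) (∣-∣-sym p q) h)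

  ≤⇒-≤ : ∀ {p q ε} → p ℚ.≤ q ℚ.+ ε → p ℚ.- q ℚ.≤ ε
  ≤⇒-≤ {p} {q} {ε} h = subst (p ℚ.- q ℚ.≤_) lem (ℚ.+-monoˡ-≤ (ℚ.- q) h)
    where
    open +-*-Solver
    lem : (q ℚ.+ ε) ℚ.- q ≡ ε
    lem = solve 2 (λ q ε → (q :+ ε) :- q := ε) refl q ε

  ≤⇒close : ∀ {p q ε} → p ℚ.≤ q ℚ.+ ε → q ℚ.≤ p ℚ.+ ε → ℚ.∣ p ℚ.- q ∣ ℚ.≤ ε
  ≤⇒close {p} {q} {ε} h₁ h₂ with ℚ.∣p∣≡p∨∣p∣≡-p (p ℚ.- q)
  ... | inj₁ eq = subst (ℚ._≤ ε) (sym eq) (≤⇒-≤ h₁)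
  ... | inj₂ eq = subst (ℚ._≤ ε) (sym (trans eq lem)) (≤⇒-≤ h₂)
    where
    open +-*-Solver
    lem : ℚ.- (p ℚ.- q) ≡ q ℚ.- p
    lem = solve 2 (λ p q → :- (p :- q) := q :- p) refl p q

  const-cauchy : ∀ q → IsCauchy (λ _ → q)
  const-cauchy q ε 0<ε = 0 , λ _ _ _ _ →
    subst (ℚ._≤ ε) (sym (cong ℚ.∣_∣ (ℚ.+-inverseʳ q))) (ℚ.<⇒≤ 0<ε)

  +-cauchy : ∀ s t → IsCauchy s → IsCauchy t → IsCauchy (λ i → s i ℚ.+ t i)
  +-cauchy s t cs ct ε 0<ε with cs _ (½ε>0 0<ε) | ct _ (½ε>0 0<ε)
  ... | M , hs | N , ht = M ℕ.⊔ N , λ i j i≥ j≥ →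
    subst₂ ℚ._≤_ (cong ℚ.∣_∣ (lem (s i) (t i) (s j) (t j))) (½ε+½ε ε)
      (ℚ.≤-trans (ℚ.∣p+q∣≤∣p∣+∣q∣ (s i ℚ.- s j) (t i ℚ.- t j))
        (ℚ.+-mono-≤
          (hs i j (ℕ.m⊔n≤o⇒m≤o M N i≥) (ℕ.m⊔n≤o⇒m≤o M N j≥))
          (ht i j (ℕ.m⊔n≤o⇒n≤o M N i≥) (ℕ.m⊔n≤o⇒n≤o M N j≥))))
    where
    open +-*-Solver
    lem : ∀ a b c d → (a ℚ.- c) ℚ.+ (b ℚ.- d) ≡ (a ℚ.+ b) ℚ.- (c ℚ.+ d)
    lem = solve 4 (λ a b c d → (a :- c) :+ (b :- d) := (a :+ b) :- (c :+ d)) refl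

  *-cauchy : ∀ s t → IsCauchy s → IsCauchy t → IsCauchy (λ i → s i ℚ.* t i)
  *-cauchy s t cs ct ε 0<ε = N , λ i j i≥ j≥ →
    subst₂ ℚ._≤_ (cong ℚ.∣_∣ (lem (s i) (t i) (s j) (t j))) (½ε+½ε ε)
      (ℚ.≤-trans
        (ℚ.∣p+q∣≤∣p∣+∣q∣ (s i ℚ.* (t i ℚ.- t j)) ((s i ℚ.- s j) ℚ.* t j))
        (ℚ.+-mono-≤
          (bound (s i) (t i ℚ.- t j) (s-bdd i (from₁ i≥)) (h₂ i j (from₄ i≥) (from₄ j≥)))
          (subst (λ z → ℚ.∣ z ∣ ℚ.≤ ½ ℚ.* ε) (ℚ.*-comm (t j) (s i ℚ.- s j))
            (bound (t j) (s i ℚ.- s j) (t-bdd j (from₂ j≥)) (h₁ i j (from₃ i≥) (from₃ j≥))))))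
    where
    open +-*-Solver
    0<1 = ℚ.positive⁻¹ 1ℚ
    M₁ = proj₁ (cs 1ℚ 0<1)
    M₂ = proj₁ (ct 1ℚ 0<1)
    a = ℚ.∣ s M₁ ∣
    b = ℚ.∣ t M₂ ∣
    B = a ℚ.+ b ℚ.+ 1ℚ

    B>0 : 0ℚ ℚ.< B
    B>0 = ℚ.+-mono-≤-< (ℚ.+-mono-≤ (ℚ.0≤∣p∣ (s M₁)) (ℚ.0≤∣p∣ (t M₂))) 0<1

    instance
      B-pos : ℚ.Positive B
      B-pos = ℚ.positive B>0
      B-nonZero : ℚ.NonZero B
      B-nonZero = ℚ.pos⇒nonZero B
      B-nonNeg : ℚ.NonNegative B
      B-nonNeg = ℚ.pos⇒nonNeg B

    δ = ℚ.1/ B ℚ.* (½ ℚ.* ε)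

    δ>0 : 0ℚ ℚ.< δ
    δ>0 = *-pos (ℚ.positive⁻¹ (ℚ.1/ B) {{ℚ.1/pos⇒pos B}}) (½ε>0 0<ε)

    Bδ : B ℚ.* δ ≡ ½ ℚ.* ε
    Bδ = trans (sym (ℚ.*-assoc B (ℚ.1/ B) (½ ℚ.* ε)))
      (trans (cong (ℚ._* (½ ℚ.* ε)) (ℚ.*-inverseʳ B)) (ℚ.*-identityˡ _))

    M₃ = proj₁ (cs δ δ>0)
    M₄ = proj₁ (ct δ δ>0)
    h₁ = proj₂ (cs δ δ>0)
    h₂ = proj₂ (ct δ δ>0)
    N = (M₁ ℕ.⊔ M₂) ℕ.⊔ (M₃ ℕ.⊔ M₄)

    from₁ : ∀ {i} → N ℕ.≤ i → M₁ ℕ.≤ i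
    from₁ = ℕ.m⊔n≤o⇒m≤o M₁ M₂ ∘ ℕ.m⊔n≤o⇒m≤o (M₁ ℕ.⊔ M₂) (M₃ ℕ.⊔ M₄)
    from₂ : ∀ {i} → N ℕ.≤ i → M₂ ℕ.≤ i
    from₂ = ℕ.m⊔n≤o⇒n≤o M₁ M₂ ∘ ℕ.m⊔n≤o⇒m≤o (M₁ ℕ.⊔ M₂) (M₃ ℕ.⊔ M₄)
    from₃ : ∀ {i} → N ℕ.≤ i → M₃ ℕ.≤ i
    from₃ = ℕ.m⊔n≤o⇒m≤o M₃ M₄ ∘ ℕ.m⊔n≤o⇒n≤o (M₁ ℕ.⊔ M₂) (M₃ ℕ.⊔ M₄)
    from₄ : ∀ {i} → N ℕ.≤ i → M₄ ℕ.≤ i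
    from₄ = ℕ.m⊔n≤o⇒n≤o M₃ M₄ ∘ ℕ.m⊔n≤o⇒n≤o (M₁ ℕ.⊔ M₂) (M₃ ℕ.⊔ M₄)

    near : ∀ p q → ℚ.∣ p ℚ.- q ∣ ℚ.≤ 1ℚ → ℚ.∣ p ∣ ℚ.≤ ℚ.∣ q ∣ ℚ.+ 1ℚ
    near p q h = subst (λ z → ℚ.∣ z ∣ ℚ.≤ ℚ.∣ q ∣ ℚ.+ 1ℚ)
      (solve 2 (λ p q → q :+ (p :- q) := p) refl p q)
      (ℚ.≤-trans (ℚ.∣p+q∣≤∣p∣+∣q∣ q (p ℚ.- q)) (ℚ.+-monoʳ-≤ ℚ.∣ q ∣ h))

    a≤a+b : a ℚ.≤ a ℚ.+ b
    a≤a+b = subst (ℚ._≤ a ℚ.+ b) (ℚ.+-identityʳ a) (ℚ.+-monoʳ-≤ a (ℚ.0≤∣p∣ (t M₂)))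

    b≤a+b : b ℚ.≤ a ℚ.+ b
    b≤a+b = subst (ℚ._≤ a ℚ.+ b) (ℚ.+-identityˡ b) (ℚ.+-monoˡ-≤ b (ℚ.0≤∣p∣ (s M₁)))

    s-bdd : ∀ i → M₁ ℕ.≤ i → ℚ.∣ s i ∣ ℚ.≤ B
    s-bdd i i≥ = ℚ.≤-trans (near (s i) (s M₁) (proj₂ (cs 1ℚ 0<1) i M₁ i≥ ℕ.≤-refl))
      (ℚ.+-monoˡ-≤ 1ℚ a≤a+b)

    t-bdd : ∀ i → M₂ ℕ.≤ i → ℚ.∣ t i ∣ ℚ.≤ B
    t-bdd i i≥ = ℚ.≤-trans (near (t i) (t M₂) (proj₂ (ct 1ℚ 0<1) i M₂ i≥ ℕ.≤-refl))
      (ℚ.+-monoˡ-≤ 1ℚ b≤a+b)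

    bound : ∀ p q → ℚ.∣ p ∣ ℚ.≤ B → ℚ.∣ q ∣ ℚ.≤ δ → ℚ.∣ p ℚ.* q ∣ ℚ.≤ ½ ℚ.* ε
    bound p q hp hq = subst₂ ℚ._≤_ (sym (ℚ.∣p*q∣≡∣p∣*∣q∣ p q)) Bδ
      (ℚ.≤-trans (ℚ.*-monoʳ-≤-nonNeg ℚ.∣ q ∣ {{ℚ.∣-∣-nonNeg q}} hp)
        (ℚ.*-monoˡ-≤-nonNeg B hq))

    lem : ∀ a b c d → a ℚ.* (b ℚ.- d) ℚ.+ (a ℚ.- c) ℚ.* d ≡ a ℚ.* b ℚ.- c ℚ.* d
    lem = solve 4 (λ a b c d → a :* (b :- d) :+ (a :- c) :* d := a :* b :- c :* d) refl

  ∣-∣-cauchy : ∀ s → IsCauchy s → IsCauchy (λ i → ℚ.∣ s i ∣)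
  ∣-∣-cauchy s cs ε 0<ε = map₂
    (λ h i j i≥ j≥ → ≤⇒close (half (s i) (s j) (h i j i≥ j≥)) (half (s j) (s i) (h j i j≥ i≥)))
    (cs ε 0<ε)
    where
    open +-*-Solver
    half : ∀ p q → ℚ.∣ p ℚ.- q ∣ ℚ.≤ ε → ℚ.∣ p ∣ ℚ.≤ ℚ.∣ q ∣ ℚ.+ ε
    half p q h = subst (λ z → ℚ.∣ z ∣ ℚ.≤ ℚ.∣ q ∣ ℚ.+ ε)
      (solve 2 (λ p q → q :+ (p :- q) := p) refl p q)
      (ℚ.≤-trans (ℚ.∣p+q∣≤∣p∣+∣q∣ q (p ℚ.- q)) (ℚ.+-monoʳ-≤ ℚ.∣ q ∣ h))

  ⊔-cauchy : ∀ s t → IsCauchy s → IsCauchy t → IsCauchy (λ i → s i ℚ.⊔ t i)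
  ⊔-cauchy s t cs ct ε 0<ε with cs ε 0<ε | ct ε 0<ε
  ... | M , hs | N , ht = M ℕ.⊔ N , λ i j i≥ j≥ →
    let hs′ = hs i j (ℕ.m⊔n≤o⇒m≤o M N i≥) (ℕ.m⊔n≤o⇒m≤o M N j≥)
        ht′ = ht i j (ℕ.m⊔n≤o⇒n≤o M N i≥) (ℕ.m⊔n≤o⇒n≤o M N j≥)
    in ≤⇒close
         (half (s i) (t i) (s j) (t j)
           (close⇒≤ (s i) (s j) hs′) (close⇒≤ (t i) (t j) ht′))
         (half (s j) (t j) (s i) (t i)
           (close⇒≥ (s i) (s j) hs′) (close⇒≥ (t i) (t j) ht′))
    where
    half : ∀ p q p′ q′ → p ℚ.≤ p′ ℚ.+ ε → q ℚ.≤ q′ ℚ.+ ε →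
           p ℚ.⊔ q ℚ.≤ (p′ ℚ.⊔ q′) ℚ.+ ε
    half p q p′ q′ h₁ h₂ = ℚ.⊔-lub
      (ℚ.≤-trans h₁ (ℚ.+-monoˡ-≤ ε (ℚ.p≤p⊔q p′ q′)))
      (ℚ.≤-trans h₂ (ℚ.+-monoˡ-≤ ε (ℚ.p≤q⊔p p′ q′)))

fromℚ : ℚ → ℝ
fromℚ q = mkℝ (λ _ → q) (const-cauchy q)

0ℝ 1ℝ 2ℝ : ℝ
0ℝ = fromℚ 0ℚ
1ℝ = fromℚ 1ℚ
2ℝ = fromℚ (+ 2 ℚ./ 1)

infixl 6 _+_ _⊔_
infixl 7 _*_

_+_ _*_ _⊔_ : ℝ → ℝ → ℝ
x + y = mkℝ (λ i → seq x i ℚ.+ seq y i) (+-cauchy (seq x) (seq y) (cauchy x) (cauchy y))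
x * y = mkℝ (λ i → seq x i ℚ.* seq y i) (*-cauchy (seq x) (seq y) (cauchy x) (cauchy y))
x ⊔ y = mkℝ (λ i → seq x i ℚ.⊔ seq y i) (⊔-cauchy (seq x) (seq y) (cauchy x) (cauchy y))

∣_∣ : ℝ → ℝ
∣ x ∣ = mkℝ (λ i → ℚ.∣ seq x i ∣) (∣-∣-cauchy (seq x) (cauchy x))

2^ 2^- : ℕ → ℝ
2^  n = fromℚ (+ (2 ℕ.^ n) ℚ./ 1)
2^- n = fromℚ ((+ 1 ℚ./ (2 ℕ.^ n)) {{ℕ.m^n≢0 2 n}})

sumOver : {A : Set} → List A → (A → ℝ) → ℝ
sumOver xs g = foldr (λ x r → g x + r) 0ℝ xs

-- Only used for families of nonnegative reals, so starting the fold at 0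
-- does not change the maximum.
maxOver : {A : Set} → List A → (A → ℝ) → ℝ
maxOver xs g = foldr (λ x r → g x ⊔ r) 0ℝ xs

-- 𝔽₂ is Bool, with addition xor and multiplication ∧.

𝔽₂^ : ℕ → Set
𝔽₂^ n = Vec Bool n

infixl 6 _⊕_
infixr 7 _·_

0ᵥ : ∀ {n} → 𝔽₂^ n
0ᵥ = replicate _ false

_⊕_ : ∀ {n} → 𝔽₂^ n → 𝔽₂^ n → 𝔽₂^ n
_⊕_ = zipWith _xor_

_·_ : ∀ {n} → Bool → 𝔽₂^ n → 𝔽₂^ n
c · x = Vec.map (c ∧_) x

⟨_,_⟩ : ∀ {n} → 𝔽₂^ n → 𝔽₂^ n → Bool
⟨ x , z ⟩ = Vec.foldr′ _xor_ false (zipWith _∧_ x z)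

lincomb : ∀ {n d} → Vec Bool d → Vec (𝔽₂^ n) d → 𝔽₂^ n
lincomb c b = Vec.foldr′ _⊕_ 0ᵥ (zipWith _·_ c b)

vecs : {A : Set} → List A → ∀ n → List (Vec A n)
vecs xs zero    = [] ∷ []
vecs xs (suc n) = cartesianProductWith _∷_ xs (vecs xs n)

bools : List Bool
bools = false ∷ true ∷ []

cube : ∀ n → List (𝔽₂^ n)
cube = vecs bools

Complete : {A : Set} → List A → Set
Complete xs = ∀ x → x ∈ xs

vecs-complete : {A : Set} {xs : List A} → Complete xs → ∀ n → Complete (vecs xs n)
vecs-complete h zero    []      = here refl
vecs-complete h (suc n) (x ∷ v) =
  ∈-cartesianProductWith⁺ _∷_ (h x) (vecs-complete h n v)

bools-complete : Complete bools
bools-complete false = here refl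
bools-complete true  = there (here refl)

cube-complete : ∀ n → Complete (cube n)
cube-complete = vecs-complete bools-complete

∀? : {A : Set} {xs : List A} → Complete xs →
     {P : A → Set} → Decidable P → Dec (∀ x → P x)
∀? {xs = xs} h P? = map′ (λ ps x → All.lookup ps (h x)) (λ p → All.universal p xs) (all? P? xs)

∃? : {A : Set} {xs : List A} → Complete xs →
     {P : A → Set} → Decidable P → Dec (∃ P)
∃? {xs = xs} h P? =
  map′ (λ p → let x , _ , px = find p in x , px) (λ (x , px) → lose (h x) px) (any? P? xs)

Subset : ℕ → Set
Subset n = 𝔽₂^ n → Bool

-- Every characteristic function, once up to pointwise equality.
subsets : ∀ n → List (Subset n)
subsets zero    = (λ _ → false) ∷ (λ _ → true) ∷ []
subsets (suc n) = cartesianProductWith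
  (λ { S₀ S₁ (b ∷ x) → if b then S₁ x else S₀ x }) (subsets n) (subsets n)

subsets-complete : ∀ n (S : Subset n) → ∃[ S′ ] S′ ∈ subsets n × S′ ≗ S
subsets-complete zero S with S [] in eq
... | false = _ , here refl , λ { [] → sym eq }
... | true  = _ , there (here refl) , λ { [] → sym eq }
subsets-complete (suc n) S
  with subsets-complete n (S ∘ (false ∷_)) | subsets-complete n (S ∘ (true ∷_))
... | _ , m₀ , e₀ | _ , m₁ , e₁ =
  _ , ∈-cartesianProductWith⁺ _ m₀ m₁ , λ { (false ∷ x) → e₀ x ; (true ∷ x) → e₁ x }

IsLinear : ∀ {n} → Subset n → Set
IsLinear V = T (V 0ᵥ)
           × (∀ x y → T (V x) → T (V y) → T (V (x ⊕ y)))
           × (∀ c x → T (V x) → T (V (c · x)))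

Independent : ∀ {n d} → Vec (𝔽₂^ n) d → Set
Independent b = ∀ c → lincomb c b ≡ 0ᵥ → c ≡ 0ᵥ

Spans : ∀ {n d} → Vec (𝔽₂^ n) d → Subset n → Set
Spans b V = (∀ c → T (V (lincomb c b)))
          × (∀ x → T (V x) → ∃[ c ] lincomb c b ≡ x)

HasDim : ∀ {n} → Subset n → ℕ → Set
HasDim {n} V d = ∃[ b ] Independent {n} {d} b × Spans b V

IsLinearOfCodim : ∀ {n} → ℕ → Subset n → Set
IsLinearOfCodim {n} k V = IsLinear V × ∃[ d ] d ℕ.+ k ≡ n × HasDim V d

-- The translate a + V: x lies in it iff x − a = a ⊕ x lies in V.
translate : ∀ {n} → 𝔽₂^ n → Subset n → Subset n
translate a V x = V (a ⊕ x)

IsTranslateOf : ∀ {n} → (Subset n → Set) → Subset n → Set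
IsTranslateOf P S = ∃[ a ] ∃[ V ] P V × S ≗ translate a V

IsAffine : ∀ {n} → Subset n → Set
IsAffine = IsTranslateOf IsLinear

IsAffineOfCodim : ∀ {n} → ℕ → Subset n → Set
IsAffineOfCodim k = IsTranslateOf (IsLinearOfCodim k)

private
  Respects≗ : ∀ {n} → (Subset n → Set) → Set
  Respects≗ {n} P = ∀ {S S′ : Subset n} → S ≗ S′ → P S → P S′

  ⊕-cancel : ∀ {n} (a x : 𝔽₂^ n) → a ⊕ (a ⊕ x) ≡ x
  ⊕-cancel []      []      = refl
  ⊕-cancel (a ∷ u) (x ∷ v) = cong₂ _∷_
    (trans (sym (xor-assoc a a x)) (cong (_xor x) (xor-same a)))
    (⊕-cancel u v)

  linear-resp : ∀ {n} → Respects≗ (IsLinear {n})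
  linear-resp e (z , p , s) =
      subst T (e _) z
    , (λ x y hx hy → subst T (e _) (p x y (subst T (sym (e _)) hx) (subst T (sym (e _)) hy)))
    , (λ c x hx → subst T (e _) (s c x (subst T (sym (e _)) hx)))

  dim-resp : ∀ {n d} → Respects≗ {n} (λ V → HasDim V d)
  dim-resp e (b , ind , to , from) =
    b , ind , (λ c → subst T (e _) (to c)) , (λ x hx → from x (subst T (sym (e _)) hx))

  codim-resp : ∀ {n k} → Respects≗ {n} (IsLinearOfCodim k)
  codim-resp e (lin , d , eq , dim) = linear-resp e lin , d , eq , dim-resp e dim

  linear? : ∀ {n} → Decidable (IsLinear {n})
  linear? {n} V =
    T? _ ×-dec
    ∀? (cube-complete n) (λ x → ∀? (cube-complete n) λ y → T? _ →-dec (T? _ →-dec T? _)) ×-dec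
    ∀? bools-complete (λ c → ∀? (cube-complete n) λ x → T? _ →-dec T? _)

  _≟_ : ∀ {n} (x y : 𝔽₂^ n) → Dec (x ≡ y)
  _≟_ = ≡-dec Bool._≟_

  dim? : ∀ {n} d → Decidable (λ (V : Subset n) → HasDim V d)
  dim? {n} d V = ∃? (vecs-complete (cube-complete n) d) λ b →
    ∀? (cube-complete d) (λ c → (lincomb c b ≟ 0ᵥ) →-dec (c ≟ 0ᵥ)) ×-dec
    (∀? (cube-complete d) (λ c → T? _) ×-dec
     ∀? (cube-complete n) (λ x → T? _ →-dec ∃? (cube-complete d) (λ c → lincomb c b ≟ x)))

  codim? : ∀ {n} k → Decidable (IsLinearOfCodim {n} k)
  codim? {n} k V = linear? V ×-dec help
    where
    help : Dec (∃[ d ] d ℕ.+ k ≡ n × HasDim V d)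
    help with k ℕ.≤? n
    ... | no k≰n  = no λ (d , eq , _) → k≰n (subst (k ℕ.≤_) eq (ℕ.m≤n+m k d))
    ... | yes k≤n = map′
      (λ dim → n ℕ.∸ k , ℕ.m∸n+n≡m k≤n , dim)
      (λ (d , eq , dim) → subst (HasDim V)
        (trans (sym (ℕ.m+n∸n≡m d k)) (cong (ℕ._∸ k) eq)) dim)
      (dim? (n ℕ.∸ k) V)

  translateOf? : ∀ {n} {P : Subset n → Set} → Respects≗ P → Decidable P →
                 Decidable (IsTranslateOf P)
  translateOf? {n} {P} resp P? S = ∃? (cube-complete n) λ a → map′
    (λ p → translate a S , p , λ x → cong S (sym (⊕-cancel a x)))
    (λ (V , p , e) → resp (λ x → trans (sym (cong V (⊕-cancel a x))) (sym (e (a ⊕ x)))) p)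
    (P? (translate a S))

isAffine? : ∀ {n} → Decidable (IsAffine {n})
isAffine? = translateOf? linear-resp linear?

isAffineOfCodim? : ∀ {n} k → Decidable (IsAffineOfCodim {n} k)
isAffineOfCodim? k = translateOf? codim-resp (codim? k)

𝒮 𝒪 : ∀ n → List (Subset n)
𝒮 n = filter isAffine? (subsets n)
𝒪 n = filter (isAffineOfCodim? 1) (subsets n)

-1^_ : Bool → ℝ
-1^ false = 1ℝ
-1^ true  = fromℚ (ℚ.- 1ℚ)

IsProbability : ∀ {n} → (𝔽₂^ n → ℝ) → Set
IsProbability {n} μ = (∀ x → 0ℝ ≤ μ x) × sumOver (cube n) μ ≃ 1ℝ

bias : ∀ {n} → (𝔽₂^ n → Bool) → (𝔽₂^ n → ℝ) → Subset n → ℝ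
bias {n} f μ S = ∣ sumOver (filterᵇ S (cube n)) (λ x → -1^ (f x) * μ x) ∣

signedDensity : ∀ {n} → (𝔽₂^ n → Bool) → (𝔽₂^ n → ℝ) → 𝔽₂^ n → ℝ
signedDensity {n} f μ x = -1^ (f x) * μ x * 2^ n

fourier : ∀ {n} → (𝔽₂^ n → ℝ) → 𝔽₂^ n → ℝ
fourier {n} F z = 2^- n * sumOver (cube n) (λ x → F x * -1^ ⟨ x , z ⟩)

‖_‖∞ : ∀ {n} → (𝔽₂^ n → ℝ) → ℝ
‖_‖∞ {n} G = maxOver (cube n) (λ z → ∣ G z ∣)

{-# OPTIONS --safe #-}

-- Every quantity is built from the values of μ by finite sums, products, ∣_∣ and ⊔,
-- which act indexwise on Cauchy sequences, so it suffices to compare the rational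
-- approximants at each index.  There F̂_μ(z) is the character sum of g = (-1)^f μ,
-- since the factors 2^n and 2^-n cancel.
--
-- Sums over affine subspaces are bounded by induction on n, splitting S on its
-- first coordinate into S₀ and S₁.  If one slice is empty, the character sums of
-- the other half of g are averages of two character sums of g.  Otherwise
-- S₁ = S₀ + w, and S sums g to what S₀ sums h(x) = g(0,x) + g(1,x+w) to, where
-- ĥ(z) = ĝ(⟨w,z⟩,z).
--
-- Conversely, ĝ(z) is the difference of the sums of g over the two hyperplanes
-- orthogonal to z if z ≠ 0, and ĝ(0) is the sum over any two parallel hyperplanes.

module Submission where

open import Data.Bool.Base using (Bool; true; false; _∧_; _xor_; not; if_then_else_; T)
open import Data.Bool.Properties using (T?; ∧-identityʳ; ∧-zeroʳ; xor-assoc; xor-same)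
open import Data.Bool.Solver using (module xor-∧-Solver)
open import Data.Empty using (⊥-elim)
open import Data.Integer.Base using (+_)
open import Data.List.Base using (List; []; _∷_; _++_; map; foldr; filterᵇ)
open import Data.List.Membership.Propositional using (_∈_)
open import Data.List.Membership.Propositional.Properties using (∈-filter⁺; ∈-filter⁻)
open import Data.List.Properties using (++-identityʳ)
open import Data.List.Relation.Unary.Any using (here; there)
open import Data.Nat.Base as ℕ using (ℕ; zero; suc)
import Data.Nat.Properties as ℕ
open import Data.Product using (_×_; _,_; ∃-syntax; proj₁; proj₂)
open import Data.Rational.Base as ℚ using (ℚ; 0ℚ; 1ℚ)
import Data.Rational.Properties as ℚ
open import Data.Rational.Solver using (module +-*-Solver)
import Data.Rational.Unnormalised.Base as ℚᵘ
import Data.Rational.Unnormalised.Properties as ℚᵘ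
open import Data.Sum.Base using (_⊎_; inj₁; inj₂)
open import Data.Unit.Base using (tt)
open import Data.Vec.Base using ([]; _∷_)
open import Data.Vec.Properties using (∷-injectiveˡ; ∷-injectiveʳ)
open import Function.Base using (_∘_)
open import Relation.Binary.PropositionalEquality
  using (_≡_; _≗_; refl; sym; trans; cong; cong₂; subst)
open import Relation.Nullary.Decidable using (yes; no)
open import Relation.Nullary.Negation using (¬_; contradiction)
open import Defs

-- Linear algebra over 𝔽₂

⊕-identityˡ : ∀ {n} (x : 𝔽₂^ n) → 0ᵥ ⊕ x ≡ x
⊕-identityˡ []      = refl
⊕-identityˡ (_ ∷ x) = cong (_ ∷_) (⊕-identityˡ x)

⊕-same : ∀ {n} (x : 𝔽₂^ n) → x ⊕ x ≡ 0ᵥ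
⊕-same []      = refl
⊕-same (a ∷ x) = cong₂ _∷_ (xor-same a) (⊕-same x)

⊕-involutive : ∀ {n} (x w : 𝔽₂^ n) → x ⊕ w ⊕ w ≡ x
⊕-involutive []      []      = refl
⊕-involutive (a ∷ x) (b ∷ w) = cong₂ _∷_ (lem a b) (⊕-involutive x w)
  where
  open xor-∧-Solver
  lem : ∀ a b → (a xor b) xor b ≡ a
  lem = solve 2 (λ a b → (a :+ b) :+ b := a) refl

-- The three copies of `a` on the left collapse to one in characteristic 2. This is why an odd
-- number of points is used to describe closure of a translate.
⊕-translate₃ : ∀ {n} (a x y z : 𝔽₂^ n) →
  (a ⊕ x) ⊕ (a ⊕ y) ⊕ (a ⊕ z) ≡ a ⊕ (x ⊕ y ⊕ z)
⊕-translate₃ []      []      []      []      = refl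
⊕-translate₃ (a ∷ u) (b ∷ x) (c ∷ y) (d ∷ z) = cong₂ _∷_ (lem a b c d) (⊕-translate₃ u x y z)
  where
  open xor-∧-Solver
  lem : ∀ a b c d → ((a xor b) xor (a xor c)) xor (a xor d) ≡ a xor ((b xor c) xor d)
  lem = solve 4 (λ a b c d → ((a :+ b) :+ (a :+ c)) :+ (a :+ d) := a :+ ((b :+ c) :+ d)) refl

⊕-translate-cancel : ∀ {n} (x u v : 𝔽₂^ n) → (x ⊕ (u ⊕ v)) ⊕ v ⊕ u ≡ x
⊕-translate-cancel []      []      []      = refl
⊕-translate-cancel (a ∷ x) (b ∷ u) (c ∷ v) = cong₂ _∷_ (lem a b c) (⊕-translate-cancel x u v)
  where
  open xor-∧-Solver
  lem : ∀ a b c → ((a xor (b xor c)) xor c) xor b ≡ a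
  lem = solve 3 (λ a b c → ((a :+ (b :+ c)) :+ c) :+ b := a) refl

⊕-assoc : ∀ {n} (x y z : 𝔽₂^ n) → x ⊕ y ⊕ z ≡ x ⊕ (y ⊕ z)
⊕-assoc []      []      []      = refl
⊕-assoc (a ∷ x) (b ∷ y) (c ∷ z) = cong₂ _∷_ (xor-assoc a b c) (⊕-assoc x y z)

⟨⟩-⊕ : ∀ {n} (x y z : 𝔽₂^ n) → ⟨ x ⊕ y , z ⟩ ≡ ⟨ x , z ⟩ xor ⟨ y , z ⟩
⟨⟩-⊕ []      []      []      = refl
⟨⟩-⊕ (a ∷ x) (b ∷ y) (c ∷ z) =
  trans (cong (((a xor b) ∧ c) xor_) (⟨⟩-⊕ x y z)) (lem a b c ⟨ x , z ⟩ ⟨ y , z ⟩)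
  where
  open xor-∧-Solver
  lem : ∀ a b c p q → ((a xor b) ∧ c) xor (p xor q) ≡ ((a ∧ c) xor p) xor ((b ∧ c) xor q)
  lem = solve 5 (λ a b c p q →
    ((a :+ b) :* c) :+ (p :+ q) := ((a :* c) :+ p) :+ ((b :* c) :+ q)) refl

⟨⟩-· : ∀ {n} c (x z : 𝔽₂^ n) → ⟨ c · x , z ⟩ ≡ c ∧ ⟨ x , z ⟩
⟨⟩-· c []      []      = sym (∧-zeroʳ c)
⟨⟩-· c (a ∷ x) (b ∷ z) =
  trans (cong (((c ∧ a) ∧ b) xor_) (⟨⟩-· c x z)) (lem a b c ⟨ x , z ⟩)
  where
  open xor-∧-Solver
  lem : ∀ a b c p → ((c ∧ a) ∧ b) xor (c ∧ p) ≡ c ∧ ((a ∧ b) xor p)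
  lem = solve 4 (λ a b c p → ((c :* a) :* b) :+ (c :* p) := c :* ((a :* b) :+ p)) refl

⟨⟩-0ˡ : ∀ {n} (z : 𝔽₂^ n) → ⟨ 0ᵥ , z ⟩ ≡ false
⟨⟩-0ˡ []      = refl
⟨⟩-0ˡ (_ ∷ z) = ⟨⟩-0ˡ z

⟨⟩-0ʳ : ∀ {n} (x : 𝔽₂^ n) → ⟨ x , 0ᵥ ⟩ ≡ false
⟨⟩-0ʳ []      = refl
⟨⟩-0ʳ (a ∷ x) = cong₂ _xor_ (∧-zeroʳ a) (⟨⟩-0ʳ x)

-- For `z` nonzero the useful datum is a vector `a` off the hyperplane orthogonal to `z`: it later
-- serves as the translation between the two parallel hyperplanes. The standard basis vector at the
-- first `true` coordinate of `z` is such an `a`.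
zero-or-witness : ∀ {n} (z : 𝔽₂^ n) → z ≡ 0ᵥ ⊎ ∃[ a ] ⟨ a , z ⟩ ≡ true
zero-or-witness []          = inj₁ refl
zero-or-witness (true ∷ z)  = inj₂ (true ∷ 0ᵥ , cong not (⟨⟩-0ˡ z))
zero-or-witness (false ∷ z) with zero-or-witness z
... | inj₁ z≡0     = inj₁ (cong (false ∷_) z≡0)
... | inj₂ (a , e) = inj₂ (false ∷ a , e)

Additive : ∀ {d n} → (𝔽₂^ d → 𝔽₂^ n) → Set
Additive φ = ∀ x y → φ (x ⊕ y) ≡ φ x ⊕ φ y

additive-0 : ∀ {d n} (φ : 𝔽₂^ d → 𝔽₂^ n) → Additive φ → φ 0ᵥ ≡ 0ᵥ
additive-0 φ add = trans (cong φ (sym (⊕-same 0ᵥ))) (trans (add 0ᵥ 0ᵥ) (⊕-same (φ 0ᵥ)))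

true· : ∀ {n} (x : 𝔽₂^ n) → true · x ≡ x
true· []      = refl
true· (_ ∷ x) = cong (_ ∷_) (true· x)

false· : ∀ {n} (x : 𝔽₂^ n) → false · x ≡ 0ᵥ
false· []      = refl
false· (_ ∷ x) = cong (_ ∷_) (false· x)

-- The vectors of `b` are the images of the standard basis. Additivity is enough because the only
-- scalars are 0 and 1. This turns a parametrisation of a subspace into the tuple of vectors that
-- `HasDim` asks for.
additive⇒lincomb : ∀ {d n} (φ : 𝔽₂^ d → 𝔽₂^ n) → Additive φ →
  ∃[ b ] ∀ c → lincomb c b ≡ φ c
additive⇒lincomb {zero}  φ add = [] , λ { [] → sym (additive-0 φ add) }
additive⇒lincomb {suc d} φ add
  with additive⇒lincomb (φ ∘ (false ∷_)) (λ x y → add (false ∷ x) (false ∷ y))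
... | b , hb = φ (true ∷ 0ᵥ) ∷ b , λ
  { (true ∷ c)  → trans (cong₂ _⊕_ (true· _) (hb c))
      (trans (sym (add _ _)) (cong (φ ∘ (true ∷_)) (⊕-identityˡ c)))
  ; (false ∷ c) → trans (cong₂ _⊕_ (false· _) (hb c)) (⊕-identityˡ _) }

-- Hyperplanes and their codimension

not-T⁺ : ∀ {b} → b ≡ false → T (not b)
not-T⁺ refl = tt

not-T⁻ : ∀ {b} → T (not b) → b ≡ false
not-T⁻ {false} _ = refl

-- The negated `xor` is the Boolean test for `⟨ x , z ⟩` being equal to `b`.
hyperplane : ∀ {n} → 𝔽₂^ n → Bool → Subset n
hyperplane z b x = not (b xor ⟨ x , z ⟩)

kernel-linear : ∀ {n} (z : 𝔽₂^ n) → IsLinear (hyperplane z false)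
kernel-linear z
  = not-T⁺ (⟨⟩-0ˡ z)
  , (λ x y hx hy → not-T⁺ (trans (⟨⟩-⊕ x y z) (cong₂ _xor_ (not-T⁻ hx) (not-T⁻ hy))))
  , (λ c x hx → not-T⁺ (trans (⟨⟩-· c x z) (trans (cong (c ∧_) (not-T⁻ hx)) (∧-zeroʳ c))))

-- An isomorphism from the d-dimensional space onto the orthogonal complement of `z`. Unlike an
-- explicit basis, it passes easily through the recursion on the coordinates of `z`.
record KernelParametrisation {d} (z : 𝔽₂^ (suc d)) : Set where
  field
    φ          : 𝔽₂^ d → 𝔽₂^ (suc d)
    additive   : Additive φ
    injective  : ∀ {x y} → φ x ≡ φ y → x ≡ y
    orthogonal : ∀ c → ⟨ φ c , z ⟩ ≡ false
    surjective : ∀ x → ⟨ x , z ⟩ ≡ false → ∃[ c ] φ c ≡ x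

xor≡false : ∀ a b → a xor b ≡ false → b ≡ a
xor≡false false _    e = e
xor≡false true  true _ = refl

-- At the first `true` coordinate of `z`, the equation `⟨ x , z ⟩ ≡ false` determines that
-- coordinate of `x` from the later ones, which are free. Coordinates of `x` before it do not enter
-- the equation and are passed through unchanged.
kernel-parametrisation : ∀ {d} (z : 𝔽₂^ (suc d)) {a} → ⟨ a , z ⟩ ≡ true →
  KernelParametrisation z
kernel-parametrisation (true ∷ z) _ = record
  { φ          = λ c → ⟨ c , z ⟩ ∷ c
  ; additive   = λ x y → cong (_∷ _) (⟨⟩-⊕ x y z)
  ; injective  = ∷-injectiveʳ
  ; orthogonal = λ c → trans (cong (_xor ⟨ c , z ⟩) (∧-identityʳ ⟨ c , z ⟩)) (xor-same ⟨ c , z ⟩)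
  ; surjective = λ { (b ∷ x) e → x , cong (_∷ x)
      (xor≡false b ⟨ x , z ⟩ (trans (cong (_xor ⟨ x , z ⟩) (sym (∧-identityʳ b))) e)) }
  }
-- Here `z` is zero, so no `a` can pair to `true` with it.
kernel-parametrisation {zero}  (false ∷ []) {false ∷ []} ()
kernel-parametrisation {zero}  (false ∷ []) {true ∷ []}  ()
kernel-parametrisation {suc d} (false ∷ z)  {a ∷ u} e = record
  { φ          = λ { (c ∷ x) → c ∷ φ x }
  ; additive   = λ { (c ∷ x) (c′ ∷ y) → cong (_ ∷_) (additive x y) }
  ; injective  = λ { {_ ∷ _} {_ ∷ _} e → cong₂ _∷_ (∷-injectiveˡ e) (injective (∷-injectiveʳ e)) }
  ; orthogonal = λ { (c ∷ x) → trans (drop c (φ x)) (orthogonal x) }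
  ; surjective = λ { (b ∷ x) e → let c , eq = surjective x (trans (sym (drop b x)) e)
                                 in b ∷ c , cong (b ∷_) eq }
  }
  where
  drop : ∀ b x → ⟨ b ∷ x , false ∷ z ⟩ ≡ ⟨ x , z ⟩
  drop b x = cong (_xor ⟨ x , z ⟩) (∧-zeroʳ b)
  open KernelParametrisation (kernel-parametrisation z {u} (trans (sym (drop a u)) e))

-- The basis is the image of the standard basis under `φ`: independence is injectivity of `φ`
-- together with `φ 0ᵥ ≡ 0ᵥ`, and spanning is `orthogonal` and `surjective`.
kernel-dim : ∀ {d} (z : 𝔽₂^ (suc d)) {a} → ⟨ a , z ⟩ ≡ true → HasDim (hyperplane z false) d
kernel-dim z {a} e with kernel-parametrisation z {a} e
... | k = b
  , (λ c eq → injective (trans (sym (hb c)) (trans eq (sym (additive-0 φ additive)))))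
  , (λ c → not-T⁺ (trans (cong ⟨_, z ⟩ (hb c)) (orthogonal c)))
  , (λ x hx → let c , eq = surjective x (not-T⁻ hx) in c , trans (hb c) eq)
  where
  open KernelParametrisation k
  b  = proj₁ (additive⇒lincomb φ additive)
  hb = proj₂ (additive⇒lincomb φ additive)

hyperplane-codim-1 : ∀ {d} (z : 𝔽₂^ (suc d)) {a} → ⟨ a , z ⟩ ≡ true →
  ∀ b → IsAffineOfCodim 1 (hyperplane z b)
hyperplane-codim-1 {d} z {a} e b =
    -- Since `a` pairs to `true` with `z`, the vector `b · a` pairs to `b`, so it moves the kernel
    -- onto the level set of `b`.
    b · a
  , hyperplane z false
  , (kernel-linear z , d , ℕ.+-comm d 1 , kernel-dim z {a} e)
  , λ x → cong not (sym (trans (⟨⟩-⊕ (b · a) x z)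
      (cong (_xor ⟨ x , z ⟩) (trans (⟨⟩-· b a z) (trans (cong (b ∧_) e) (∧-identityʳ b))))))

-- Over 𝔽₂ this characterises the affine subspaces together with ∅, so it passes to
-- slices, which may be empty.
TernaryClosed : ∀ {n} → Subset n → Set
TernaryClosed S = ∀ x y z → T (S x) → T (S y) → T (S z) → T (S (x ⊕ y ⊕ z))

affine⇒ternaryClosed : ∀ {n} {S : Subset n} → IsAffine S → TernaryClosed S
affine⇒ternaryClosed (a , V , (_ , V-⊕ , _) , e) x y z hx hy hz =
  subst T (trans (cong V (⊕-translate₃ a x y z)) (sym (e _)))
    (V-⊕ _ _ (V-⊕ _ _ (subst T (e x) hx) (subst T (e y) hy)) (subst T (e z) hz))

-- Sums of rationals over the cube

σ : Bool → ℚ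
σ false = 1ℚ
σ true  = ℚ.- 1ℚ

σ-xor : ∀ a b → σ (a xor b) ≡ σ a ℚ.* σ b
σ-xor false false = refl
σ-xor false true  = refl
σ-xor true  false = refl
σ-xor true  true  = refl

∑ : ∀ {n} → (𝔽₂^ n → ℚ) → ℚ
∑ {zero}  g = g []
∑ {suc n} g = ∑ (g ∘ (false ∷_)) ℚ.+ ∑ (g ∘ (true ∷_))

∑-cong : ∀ {n} {g h : 𝔽₂^ n → ℚ} → g ≗ h → ∑ g ≡ ∑ h
∑-cong {zero}  e = e []
∑-cong {suc n} e = cong₂ ℚ._+_ (∑-cong (e ∘ (false ∷_))) (∑-cong (e ∘ (true ∷_)))

∑-+ : ∀ {n} (g h : 𝔽₂^ n → ℚ) → ∑ (λ x → g x ℚ.+ h x) ≡ ∑ g ℚ.+ ∑ h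
∑-+ {zero}  g h = refl
∑-+ {suc n} g h =
  trans (cong₂ ℚ._+_ (∑-+ (g ∘ (false ∷_)) (h ∘ (false ∷_))) (∑-+ (g ∘ (true ∷_)) (h ∘ (true ∷_))))
    (lem (∑ (g ∘ (false ∷_))) (∑ (h ∘ (false ∷_))) (∑ (g ∘ (true ∷_))) (∑ (h ∘ (true ∷_))))
  where
  open +-*-Solver
  lem : ∀ a b c d → (a ℚ.+ b) ℚ.+ (c ℚ.+ d) ≡ (a ℚ.+ c) ℚ.+ (b ℚ.+ d)
  lem = solve 4 (λ a b c d → (a :+ b) :+ (c :+ d) := (a :+ c) :+ (b :+ d)) refl

∑-* : ∀ {n} c (g : 𝔽₂^ n → ℚ) → ∑ (λ x → c ℚ.* g x) ≡ c ℚ.* ∑ g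
∑-* {zero}  c g = refl
∑-* {suc n} c g = trans (cong₂ ℚ._+_ (∑-* c (g ∘ (false ∷_))) (∑-* c (g ∘ (true ∷_))))
  (sym (ℚ.*-distribˡ-+ c (∑ (g ∘ (false ∷_))) (∑ (g ∘ (true ∷_)))))

∑-0 : ∀ n → ∑ {n} (λ _ → 0ℚ) ≡ 0ℚ
∑-0 zero    = refl
∑-0 (suc n) = cong₂ ℚ._+_ (∑-0 n) (∑-0 n)

∑-shift : ∀ {n} (w : 𝔽₂^ n) (g : 𝔽₂^ n → ℚ) → ∑ (λ x → g (x ⊕ w)) ≡ ∑ g
∑-shift []          g = refl
∑-shift (false ∷ w) g = cong₂ ℚ._+_ (∑-shift w (g ∘ (false ∷_))) (∑-shift w (g ∘ (true ∷_)))
∑-shift (true ∷ w)  g =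
  trans (cong₂ ℚ._+_ (∑-shift w (g ∘ (true ∷_))) (∑-shift w (g ∘ (false ∷_))))
    (ℚ.+-comm (∑ (g ∘ (true ∷_))) (∑ (g ∘ (false ∷_))))

-- Extension by zero makes a sum over `S` a sum over the whole cube, so the recursive lemmas on `∑`
-- apply to it.
restrict : ∀ {n} → Subset n → (𝔽₂^ n → ℚ) → 𝔽₂^ n → ℚ
restrict S g x = if S x then g x else 0ℚ

∑-restrict-∅ : ∀ {n} (S : Subset n) g → (∀ x → ¬ T (S x)) → ∑ (restrict S g) ≡ 0ℚ
∑-restrict-∅ {n} S g empty = trans (∑-cong vanishes) (∑-0 n)
  where
  vanishes : restrict S g ≗ λ _ → 0ℚ
  vanishes x with S x | empty x
  ... | false | _ = refl
  ... | true  | ¬Sx = contradiction tt ¬Sx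

-- Character sums: the Fourier transform without its factor 2^-n

charSum : ∀ {n} → (𝔽₂^ n → ℚ) → 𝔽₂^ n → ℚ
charSum g z = ∑ (λ x → g x ℚ.* σ ⟨ x , z ⟩)

p*[q*r]≡q*[p*r] : ∀ p q r → p ℚ.* (q ℚ.* r) ≡ q ℚ.* (p ℚ.* r)
p*[q*r]≡q*[p*r] = solve 3 (λ p q r → p :* (q :* r) := q :* (p :* r)) refl
  where open +-*-Solver

-- The character of `c ∷ z` restricts to the character of `z` on the `false` half of the cube, and
-- to `σ c` times it on the `true` half.
charSum-∷ : ∀ {n} (g : 𝔽₂^ (suc n) → ℚ) c z →
  charSum g (c ∷ z) ≡ charSum (g ∘ (false ∷_)) z ℚ.+ σ c ℚ.* charSum (g ∘ (true ∷_)) z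
charSum-∷ {n} g c z = cong (charSum (g ∘ (false ∷_)) z ℚ.+_)
  (trans (∑-cong λ x → trans
           (cong (g (true ∷ x) ℚ.*_) (σ-xor c ⟨ x , z ⟩))
           (p*[q*r]≡q*[p*r] (g (true ∷ x)) (σ c) (σ ⟨ x , z ⟩)))
    (∑-* {n} (σ c) (λ x → g (true ∷ x) ℚ.* σ ⟨ x , z ⟩)))

charSum-shift : ∀ {n} (g : 𝔽₂^ n → ℚ) w z →
  charSum (λ x → g (x ⊕ w)) z ≡ σ ⟨ w , z ⟩ ℚ.* charSum g z
charSum-shift {n} g w z =
  -- Writing `x` as `x ⊕ w ⊕ w` makes the summand a function of `x ⊕ w`, to which `∑-shift` applies.
  trans (∑-cong λ x → cong (λ y → g (x ⊕ w) ℚ.* σ ⟨ y , z ⟩) (sym (⊕-involutive x w)))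
  (trans (∑-shift w (λ y → g y ℚ.* σ ⟨ y ⊕ w , z ⟩))
  (trans (∑-cong move)
    (∑-* {n} (σ ⟨ w , z ⟩) (λ y → g y ℚ.* σ ⟨ y , z ⟩))))
  where
  move : ∀ y → g y ℚ.* σ ⟨ y ⊕ w , z ⟩ ≡ σ ⟨ w , z ⟩ ℚ.* (g y ℚ.* σ ⟨ y , z ⟩)
  move y = trans
    (cong (g y ℚ.*_) (trans (cong σ (⟨⟩-⊕ y w z))
      (trans (σ-xor ⟨ y , z ⟩ ⟨ w , z ⟩) (ℚ.*-comm (σ ⟨ y , z ⟩) (σ ⟨ w , z ⟩)))))
    (p*[q*r]≡q*[p*r] (g y) (σ ⟨ w , z ⟩) (σ ⟨ y , z ⟩))

p+p≤q+q⇒p≤q : ∀ {p q} → p ℚ.+ p ℚ.≤ q ℚ.+ q → p ℚ.≤ q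
p+p≤q+q⇒p≤q {p} {q} h with p ℚ.≤? q
... | yes p≤q = p≤q
... | no  p≰q = ⊥-elim (ℚ.<-irrefl refl (ℚ.≤-<-trans h (ℚ.+-mono-< q<p q<p)))
  where q<p = ℚ.≰⇒> p≰q

∣p+p∣≡∣p∣+∣p∣ : ∀ p → ℚ.∣ p ℚ.+ p ∣ ≡ ℚ.∣ p ∣ ℚ.+ ℚ.∣ p ∣
∣p+p∣≡∣p∣+∣p∣ p with ℚ.≤-total 0ℚ p
... | inj₁ 0≤p = trans (ℚ.0≤p⇒∣p∣≡p (ℚ.+-mono-≤ 0≤p 0≤p))
  (sym (cong₂ ℚ._+_ (ℚ.0≤p⇒∣p∣≡p 0≤p) (ℚ.0≤p⇒∣p∣≡p 0≤p)))
... | inj₂ p≤0 = trans (sym (ℚ.∣-p∣≡∣p∣ (p ℚ.+ p)))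
  (trans (cong ℚ.∣_∣ (ℚ.neg-distrib-+ p p))
  (trans (ℚ.0≤p⇒∣p∣≡p (ℚ.+-mono-≤ 0≤-p 0≤-p))
    (cong₂ ℚ._+_ -p≡∣p∣ -p≡∣p∣)))
  where
  0≤-p : 0ℚ ℚ.≤ ℚ.- p
  0≤-p = ℚ.neg-antimono-≤ p≤0
  -p≡∣p∣ : ℚ.- p ≡ ℚ.∣ p ∣
  -p≡∣p∣ = trans (sym (ℚ.0≤p⇒∣p∣≡p 0≤-p)) (ℚ.∣-p∣≡∣p∣ p)

-- Stated with `p ℚ.+ p` so that averaging needs no division by two.
∣p∣≤-average : ∀ p q r {m} → p ℚ.+ p ≡ q ℚ.+ r → ℚ.∣ q ∣ ℚ.≤ m → ℚ.∣ r ∣ ℚ.≤ m → ℚ.∣ p ∣ ℚ.≤ m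
∣p∣≤-average p q r e hq hr = p+p≤q+q⇒p≤q (ℚ.≤-trans
  (ℚ.≤-reflexive (trans (sym (∣p+p∣≡∣p∣+∣p∣ p)) (cong ℚ.∣_∣ e)))
  (ℚ.≤-trans (ℚ.∣p+q∣≤∣p∣+∣q∣ q r) (ℚ.+-mono-≤ hq hr)))

-- By `charSum-∷` the two values at `false ∷ z` and `true ∷ z` are the sum and the difference of the
-- character sums of the halves. Twice either half is therefore the sum or the difference of these
-- two values.
∣charSum-half∣≤ : ∀ {n} (g : 𝔽₂^ (suc n) → ℚ) {m} → (∀ z → ℚ.∣ charSum g z ∣ ℚ.≤ m) →
  ∀ b z → ℚ.∣ charSum (g ∘ (b ∷_)) z ∣ ℚ.≤ m
∣charSum-half∣≤ {n} g {m} h b z = go b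
  where
  open +-*-Solver
  p q : ℚ
  p = charSum (g ∘ (false ∷_)) z
  q = charSum (g ∘ (true ∷_)) z

  sum-eq : ∀ a b → a ℚ.+ a ≡ (a ℚ.+ 1ℚ ℚ.* b) ℚ.+ (a ℚ.+ (ℚ.- 1ℚ) ℚ.* b)
  sum-eq = solve 2 (λ a b →
    a :+ a := (a :+ con 1ℚ :* b) :+ (a :+ con (ℚ.- 1ℚ) :* b)) refl

  diff-eq : ∀ a b → b ℚ.+ b ≡ (a ℚ.+ 1ℚ ℚ.* b) ℚ.- (a ℚ.+ (ℚ.- 1ℚ) ℚ.* b)
  diff-eq = solve 2 (λ a b →
    b :+ b := (a :+ con 1ℚ :* b) :- (a :+ con (ℚ.- 1ℚ) :* b)) refl

  ∣p+σq∣≤m : ∀ c → ℚ.∣ p ℚ.+ σ c ℚ.* q ∣ ℚ.≤ m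
  ∣p+σq∣≤m c = subst (λ r → ℚ.∣ r ∣ ℚ.≤ m) (charSum-∷ g c z) (h (c ∷ z))

  go : ∀ b → ℚ.∣ charSum (g ∘ (b ∷_)) z ∣ ℚ.≤ m
  go false = ∣p∣≤-average p (p ℚ.+ σ false ℚ.* q) (p ℚ.+ σ true ℚ.* q) (sum-eq p q)
    (∣p+σq∣≤m false) (∣p+σq∣≤m true)
  go true  = ∣p∣≤-average q (p ℚ.+ σ false ℚ.* q) (ℚ.- (p ℚ.+ σ true ℚ.* q)) (diff-eq p q)
    (∣p+σq∣≤m false)
    (subst (ℚ._≤ m) (sym (ℚ.∣-p∣≡∣p∣ (p ℚ.+ σ true ℚ.* q))) (∣p+σq∣≤m true))

-- Bounding sums over affine subspaces by character sums

T-ext : ∀ {a b} → (T a → T b) → (T b → T a) → a ≡ b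
T-ext {false} {false} _ _ = refl
T-ext {false} {true}  _ g = ⊥-elim (g tt)
T-ext {true}  {false} f _ = ⊥-elim (f tt)
T-ext {true}  {true}  _ _ = refl

-- Adding one point of each slice to a point of `S` flips its first coordinate and moves the rest by
-- `u ⊕ v`. Ternary closure keeps the result in `S`, and the move is its own inverse.
slice-shift : ∀ {n} (S : Subset (suc n)) → TernaryClosed S →
  ∀ u v → T (S (false ∷ u)) → T (S (true ∷ v)) →
  ∀ x → S (true ∷ (x ⊕ (u ⊕ v))) ≡ S (false ∷ x)
slice-shift S cl u v hu hv x = T-ext
  (λ h → subst (T ∘ S ∘ (false ∷_)) (⊕-translate-cancel x u v) (cl _ _ _ h hv hu))
  (λ h → subst (T ∘ S ∘ (true ∷_)) (⊕-assoc x u v) (cl _ _ _ h hu hv))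

∣∑-affine∣≤ : ∀ {n} (S : Subset n) → TernaryClosed S → ∀ (g : 𝔽₂^ n → ℚ) {m} →
  (∀ z → ℚ.∣ charSum g z ∣ ℚ.≤ m) → ℚ.∣ ∑ (restrict S g) ∣ ℚ.≤ m
∣∑-affine∣≤ {zero} S cl g h with S []
-- In dimension 0 the only character is trivial, so the character sum is `g []`. If `S` is empty, it
-- remains to see that `m` is nonnegative, which holds as it bounds an absolute value.
... | false = ℚ.≤-trans (ℚ.0≤∣p∣ (charSum g [])) (h [])
... | true  = subst (λ p → ℚ.∣ p ∣ ℚ.≤ _) (ℚ.*-identityʳ (g [])) (h [])
∣∑-affine∣≤ {suc n} S cl g {m} h
  with ∃? (cube-complete n) (T? ∘ S ∘ (false ∷_)) | ∃? (cube-complete n) (T? ∘ S ∘ (true ∷_))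
... | no ¬S₀ | _ = subst (λ p → ℚ.∣ p ∣ ℚ.≤ m)
  (sym (trans (cong (ℚ._+ ∑ (restrict (S ∘ (true ∷_)) (g ∘ (true ∷_))))
      (∑-restrict-∅ (S ∘ (false ∷_)) (g ∘ (false ∷_)) λ x hx → ¬S₀ (x , hx))) (ℚ.+-identityˡ _)))
  (∣∑-affine∣≤ (S ∘ (true ∷_)) (λ x y z → cl (true ∷ x) (true ∷ y) (true ∷ z))
    (g ∘ (true ∷_)) (∣charSum-half∣≤ g h true))
... | yes _ | no ¬S₁ = subst (λ p → ℚ.∣ p ∣ ℚ.≤ m)
  (sym (trans (cong (∑ (restrict (S ∘ (false ∷_)) (g ∘ (false ∷_))) ℚ.+_)
      (∑-restrict-∅ (S ∘ (true ∷_)) (g ∘ (true ∷_)) λ x hx → ¬S₁ (x , hx))) (ℚ.+-identityʳ _)))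
  (∣∑-affine∣≤ (S ∘ (false ∷_)) (λ x y z → cl (false ∷ x) (false ∷ y) (false ∷ z))
    (g ∘ (false ∷_)) (∣charSum-half∣≤ g h false))
... | yes (u , hu) | yes (v , hv) = subst (λ p → ℚ.∣ p ∣ ℚ.≤ m) (sym fold-eq)
  (∣∑-affine∣≤ S₀ (λ x y z → cl (false ∷ x) (false ∷ y) (false ∷ z)) folded
    (λ z → subst (λ p → ℚ.∣ p ∣ ℚ.≤ m) (sym (charSum-folded z)) (h (⟨ w , z ⟩ ∷ z))))
  where
  S₀ = S ∘ (false ∷_)
  g₀ = g ∘ (false ∷_)
  g₁ = g ∘ (true ∷_)
  w = u ⊕ v

  folded : 𝔽₂^ n → ℚ
  folded x = g₀ x ℚ.+ g₁ (x ⊕ w)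

  restrict-+ : ∀ b p q → (if b then p else 0ℚ) ℚ.+ (if b then q else 0ℚ) ≡
    (if b then p ℚ.+ q else 0ℚ)
  restrict-+ false _ _ = refl
  restrict-+ true  _ _ = refl

  -- Shifting the `true` half by `w` carries its slice of `S` to `S₀`, so both halves become sums
  -- over the same set and can be added pointwise.
  fold-eq : ∑ (restrict S g) ≡ ∑ (restrict S₀ folded)
  fold-eq =
    trans (cong (∑ (restrict S₀ g₀) ℚ.+_)
      (trans (sym (∑-shift w (restrict (S ∘ (true ∷_)) g₁)))
        (∑-cong λ x → cong (λ b → if b then g₁ (x ⊕ w) else 0ℚ) (slice-shift S cl u v hu hv x))))
    (trans (sym (∑-+ (restrict S₀ g₀) (restrict S₀ (λ x → g₁ (x ⊕ w)))))
      (∑-cong λ x → restrict-+ (S₀ x) (g₀ x) (g₁ (x ⊕ w))))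

  -- The shift by `w` multiplies the character sum of `g₁` by the sign `σ ⟨ w , z ⟩`. A first
  -- frequency coordinate `⟨ w , z ⟩` produces exactly this sign.
  charSum-folded : ∀ z → charSum folded z ≡ charSum g (⟨ w , z ⟩ ∷ z)
  charSum-folded z =
    trans (∑-cong λ x → ℚ.*-distribʳ-+ (σ ⟨ x , z ⟩) (g₀ x) (g₁ (x ⊕ w)))
    (trans (∑-+ (λ x → g₀ x ℚ.* σ ⟨ x , z ⟩) (λ x → g₁ (x ⊕ w) ℚ.* σ ⟨ x , z ⟩))
    (trans (cong (charSum g₀ z ℚ.+_) (charSum-shift g₁ w z))
      (sym (charSum-∷ g ⟨ w , z ⟩ z))))

-- Bounding character sums by hyperplane sums

hyperplane-split : ∀ {n} (g : 𝔽₂^ n → ℚ) z (τ : Bool → ℚ) →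
  ∑ (λ x → g x ℚ.* τ ⟨ x , z ⟩) ≡
  τ false ℚ.* ∑ (restrict (hyperplane z false) g) ℚ.+ τ true ℚ.* ∑ (restrict (hyperplane z true) g)
hyperplane-split g z τ =
  trans (∑-cong λ x → pointwise (g x) ⟨ x , z ⟩)
  (trans (∑-+ (λ x → τ false ℚ.* restrict (hyperplane z false) g x)
              (λ x → τ true ℚ.* restrict (hyperplane z true) g x))
    (cong₂ ℚ._+_
      (∑-* (τ false) (restrict (hyperplane z false) g))
      (∑-* (τ true) (restrict (hyperplane z true) g))))
  where
  pointwise : ∀ p b → p ℚ.* τ b ≡
    τ false ℚ.* (if not b then p else 0ℚ) ℚ.+ τ true ℚ.* (if not (not b) then p else 0ℚ)
  pointwise p false = lem p (τ false) (τ true)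
    where
    open +-*-Solver
    lem : ∀ p s t → p ℚ.* s ≡ s ℚ.* p ℚ.+ t ℚ.* 0ℚ
    lem = solve 3 (λ p s t → p :* s := s :* p :+ t :* con 0ℚ) refl
  pointwise p true = lem p (τ false) (τ true)
    where
    open +-*-Solver
    lem : ∀ p s t → p ℚ.* t ≡ s ℚ.* 0ℚ ℚ.+ t ℚ.* p
    lem = solve 3 (λ p s t → p :* t := s :* con 0ℚ :+ t :* p) refl

∣σ*p∣ : ∀ b p → ℚ.∣ σ b ℚ.* p ∣ ≡ ℚ.∣ p ∣
∣σ*p∣ false p = cong ℚ.∣_∣ (ℚ.*-identityˡ p)
∣σ*p∣ true  p = trans (ℚ.∣p*q∣≡∣p∣*∣q∣ (ℚ.- 1ℚ) p) (ℚ.*-identityˡ ℚ.∣ p ∣)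

-- The weight is constant, equal to 1 or -1, on each of the two hyperplanes orthogonal to `y`, so
-- each contributes at most `m`. The parameter `s` covers two uses: the identity gives the character
-- sum at `y`, and the constant `false` gives the plain sum of `g`.
∣∑∣≤-hyperplanes : ∀ {d} (g : 𝔽₂^ (suc d) → ℚ) {m} →
  (∀ S → IsAffineOfCodim 1 S → ℚ.∣ ∑ (restrict S g) ∣ ℚ.≤ m) →
  ∀ y {a} → ⟨ a , y ⟩ ≡ true → (s : Bool → Bool) →
  ℚ.∣ ∑ (λ x → g x ℚ.* σ (s ⟨ x , y ⟩)) ∣ ℚ.≤ m ℚ.+ m
∣∑∣≤-hyperplanes g {m} h y {a} e s =
  ℚ.≤-trans (ℚ.≤-reflexive (cong ℚ.∣_∣ (hyperplane-split g y (σ ∘ s))))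
    (ℚ.≤-trans (ℚ.∣p+q∣≤∣p∣+∣q∣ (part false) (part true)) (ℚ.+-mono-≤ (half false) (half true)))
  where
  part : Bool → ℚ
  part b = σ (s b) ℚ.* ∑ (restrict (hyperplane y b) g)

  half : ∀ b → ℚ.∣ part b ∣ ℚ.≤ m
  half b = ℚ.≤-trans (ℚ.≤-reflexive (∣σ*p∣ (s b) (∑ (restrict (hyperplane y b) g))))
    (h (hyperplane y b) (hyperplane-codim-1 y {a} e b))

∣charSum∣≤ : ∀ {n} → n ℕ.≥ 1 → (g : 𝔽₂^ n → ℚ) → ∀ {m} →
  (∀ S → IsAffineOfCodim 1 S → ℚ.∣ ∑ (restrict S g) ∣ ℚ.≤ m) →
  ∀ z → ℚ.∣ charSum g z ∣ ℚ.≤ m ℚ.+ m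
∣charSum∣≤ {suc d} _ g {m} h z with zero-or-witness z
... | inj₂ (a , e) = ∣∑∣≤-hyperplanes g h z {a} e (λ b → b)
-- At frequency 0 all weights are 1 and any pair of parallel hyperplanes will do. The pair chosen is
-- given by the first coordinate, which exists because `n` is at least 1.
... | inj₁ refl    = subst (λ p → ℚ.∣ p ∣ ℚ.≤ m ℚ.+ m)
  (∑-cong λ x → cong (λ b → g x ℚ.* σ b) (sym (⟨⟩-0ʳ x)))
  (∣∑∣≤-hyperplanes g h (true ∷ 0ᵥ) {true ∷ 0ᵥ} (cong not (⟨⟩-0ˡ {d} 0ᵥ)) (λ _ → false))

-- Passage to the reals

pointwise⇒≤ : ∀ {x y : ℝ} → (∀ i → seq x i ℚ.≤ seq y i) → x ≤ y
pointwise⇒≤ {x} {y} h ε 0<ε = 0 , λ i _ →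
  ℚ.≤-trans (h i) (subst (ℚ._≤ seq y i ℚ.+ ε) (ℚ.+-identityʳ (seq y i))
    (ℚ.+-monoʳ-≤ (seq y i) (ℚ.<⇒≤ 0<ε)))

module _ {A : Set} (g : A → ℝ) (i : ℕ) where

  0≤maxOver : ∀ xs → 0ℚ ℚ.≤ seq (maxOver xs g) i
  0≤maxOver []       = ℚ.≤-refl
  0≤maxOver (x ∷ xs) = ℚ.≤-trans (0≤maxOver xs) (ℚ.p≤q⊔p (seq (g x) i) (seq (maxOver xs g) i))

  ≤maxOver : ∀ {x xs} → x ∈ xs → seq (g x) i ℚ.≤ seq (maxOver xs g) i
  ≤maxOver {xs = y ∷ ys} (here refl) = ℚ.p≤p⊔q (seq (g y) i) (seq (maxOver ys g) i)
  ≤maxOver {xs = y ∷ ys} (there m)   =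
    ℚ.≤-trans (≤maxOver m) (ℚ.p≤q⊔p (seq (g y) i) (seq (maxOver ys g) i))

  -- The fold in `maxOver` starts at 0, so an upper bound must also dominate 0.
  maxOver≤ : ∀ xs {m} → 0ℚ ℚ.≤ m → (∀ {x} → x ∈ xs → seq (g x) i ℚ.≤ m) →
    seq (maxOver xs g) i ℚ.≤ m
  maxOver≤ []       0≤m h = 0≤m
  maxOver≤ (x ∷ xs) 0≤m h = ℚ.⊔-lub (h (here refl)) (maxOver≤ xs 0≤m (h ∘ there))

sumℚ : {A : Set} → List A → (A → ℚ) → ℚ
sumℚ xs g = foldr (λ x r → g x ℚ.+ r) 0ℚ xs

sumℚ-++ : {A : Set} (xs ys : List A) (g : A → ℚ) → sumℚ (xs ++ ys) g ≡ sumℚ xs g ℚ.+ sumℚ ys g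
sumℚ-++ []       ys g = sym (ℚ.+-identityˡ (sumℚ ys g))
sumℚ-++ (x ∷ xs) ys g = trans (cong (g x ℚ.+_) (sumℚ-++ xs ys g))
  (sym (ℚ.+-assoc (g x) (sumℚ xs g) (sumℚ ys g)))

sumℚ-map : {A B : Set} (k : A → B) (xs : List A) (g : B → ℚ) → sumℚ (map k xs) g ≡ sumℚ xs (g ∘ k)
sumℚ-map k []       g = refl
sumℚ-map k (x ∷ xs) g = cong (g (k x) ℚ.+_) (sumℚ-map k xs g)

sumℚ-cube : ∀ n (g : 𝔽₂^ n → ℚ) → sumℚ (cube n) g ≡ ∑ g
sumℚ-cube zero    g = ℚ.+-identityʳ (g [])
sumℚ-cube (suc n) g =
  -- `cartesianProductWith` over `bools` unfolds to one block per Boolean followed by an empty list,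
  -- which `++-identityʳ` removes.
  trans (sumℚ-++ (map (false ∷_) (cube n)) (map (true ∷_) (cube n) ++ []) g)
    (cong₂ ℚ._+_ (half false)
      (trans (cong (λ xs → sumℚ xs g) (++-identityʳ (map (true ∷_) (cube n)))) (half true)))
  where
  half : ∀ b → sumℚ (map (b ∷_) (cube n)) g ≡ ∑ (g ∘ (b ∷_))
  half b = trans (sumℚ-map (b ∷_) (cube n) g) (sumℚ-cube n (g ∘ (b ∷_)))

seq-sumOver : {A : Set} (xs : List A) (h : A → ℝ) (i : ℕ) →
  seq (sumOver xs h) i ≡ sumℚ xs (λ x → seq (h x) i)
seq-sumOver []       h i = refl
seq-sumOver (x ∷ xs) h i = cong (seq (h x) i ℚ.+_) (seq-sumOver xs h i)

sumℚ-filterᵇ : ∀ {n} (S : Subset n) xs g → sumℚ (filterᵇ S xs) g ≡ sumℚ xs (restrict S g)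
sumℚ-filterᵇ S []       g = refl
sumℚ-filterᵇ S (x ∷ xs) g with S x
... | false = trans (sumℚ-filterᵇ S xs g) (sym (ℚ.+-identityˡ (sumℚ xs (restrict S g))))
... | true  = cong (g x ℚ.+_) (sumℚ-filterᵇ S xs g)

seq-sign : ∀ b i → seq (-1^ b) i ≡ σ b
seq-sign false i = refl
seq-sign true  i = refl

-- Rational division reduces by the gcd and so does not compute for a variable `m`. The identity is
-- taken from the unnormalised rationals, where fractions stay as written.
1/m*m≡1 : ∀ m .{{_ : ℕ.NonZero m}} → (+ 1 ℚ./ m) ℚ.* (+ m ℚ./ 1) ≡ 1ℚ
1/m*m≡1 (suc k) = ℚ.toℚᵘ-injective
  (ℚᵘ.≃-trans (ℚ.toℚᵘ-homo-* (+ 1 ℚ./ suc k) (+ suc k ℚ./ 1))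
  (ℚᵘ.≃-trans (ℚᵘ.*-cong (ℚ.toℚᵘ-fromℚᵘ 1/m) (ℚ.toℚᵘ-fromℚᵘ m/1))
    (ℚᵘ.*-inverseˡ m/1)))
  where
  1/m = ℚᵘ.mkℚᵘ (+ 1) k
  m/1 = ℚᵘ.mkℚᵘ (+ suc k) 0

-- Used with 2^-n for `p` and 2^n for `q`, to cancel the normalisation of the Fourier transform
-- against that of the signed density.
∑-rescale : ∀ {n} (g h : 𝔽₂^ n → ℚ) p q → p ℚ.* q ≡ 1ℚ →
  p ℚ.* ∑ (λ x → (g x ℚ.* q) ℚ.* h x) ≡ ∑ (λ x → g x ℚ.* h x)
∑-rescale g h p q pq≡1 = trans (sym (∑-* p (λ x → (g x ℚ.* q) ℚ.* h x)))
  (∑-cong λ x → trans (lem p q (g x) (h x))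
    (trans (cong (ℚ._* (g x ℚ.* h x)) pq≡1) (ℚ.*-identityˡ (g x ℚ.* h x))))
  where
  open +-*-Solver
  lem : ∀ a b p s → a ℚ.* ((p ℚ.* b) ℚ.* s) ≡ (a ℚ.* b) ℚ.* (p ℚ.* s)
  lem = solve 4 (λ a b p s → a :* ((p :* b) :* s) := (a :* b) :* (p :* s)) refl

module _ {n} (f : 𝔽₂^ n → Bool) (μ : 𝔽₂^ n → ℝ) (i : ℕ) where

  signed : 𝔽₂^ n → ℚ
  signed x = σ (f x) ℚ.* seq (μ x) i

  seq-signed : ∀ x → seq (-1^ (f x) * μ x) i ≡ signed x
  seq-signed x = cong (ℚ._* seq (μ x) i) (seq-sign (f x) i)

  private
    term : 𝔽₂^ n → ℚ
    term x = seq (-1^ (f x) * μ x) i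

  seq-bias : ∀ S → seq (bias f μ S) i ≡ ℚ.∣ ∑ (restrict S signed) ∣
  seq-bias S = cong ℚ.∣_∣
    (trans (seq-sumOver (filterᵇ S (cube n)) (λ x → -1^ (f x) * μ x) i)
    (trans (sumℚ-filterᵇ S (cube n) term)
    (trans (sumℚ-cube n (restrict S term))
      (∑-cong λ x → cong (λ p → if S x then p else 0ℚ) (seq-signed x)))))

  seq-fourier : ∀ z → seq (fourier (signedDensity f μ) z) i ≡ charSum signed z
  seq-fourier z =
    trans (cong (seq (2^- n) i ℚ.*_)
      (trans (seq-sumOver (cube n) (λ x → signedDensity f μ x * -1^ ⟨ x , z ⟩) i)
        (sumℚ-cube n (λ x → (term x ℚ.* seq (2^ n) i) ℚ.* seq (-1^ ⟨ x , z ⟩) i))))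
    (trans (∑-rescale term (λ x → seq (-1^ ⟨ x , z ⟩) i) (seq (2^- n) i) (seq (2^ n) i)
             (1/m*m≡1 (2 ℕ.^ n) {{ℕ.m^n≢0 2 n}}))
      (∑-cong λ x → cong₂ ℚ._*_ (seq-signed x) (seq-sign ⟨ x , z ⟩ i)))

-- The three inequalities at each index

codim⇒affine : ∀ {n k} {S : Subset n} → IsAffineOfCodim k S → IsAffine S
codim⇒affine (a , V , (lin , _) , e) = a , V , lin , e

-- The list `𝒪 n` holds one characteristic function per class of pointwise equality, so a given `S`
-- need not be a member itself. Its representative is, and sums over the two agree.
hyperplane-representative : ∀ {n} {S : Subset n} → IsAffineOfCodim 1 S →
  ∃[ S′ ] S′ ∈ 𝒪 n × S′ ≗ S
hyperplane-representative {n} {S} (a , V , codim , e) with subsets-complete n S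
... | S′ , S′∈ , S′≗S =
    S′
  , ∈-filter⁺ (isAffineOfCodim? 1) {xs = subsets n} S′∈
      (a , V , codim , λ x → trans (S′≗S x) (e x))
  , S′≗S

bias≤maxOver-𝒪 : ∀ {n} (f : 𝔽₂^ n → Bool) (μ : 𝔽₂^ n → ℝ) i {S} → IsAffineOfCodim 1 S →
  ℚ.∣ ∑ (restrict S (signed f μ i)) ∣ ℚ.≤ seq (maxOver (𝒪 n) (bias f μ)) i
bias≤maxOver-𝒪 {n} f μ i {S} affine = go (hyperplane-representative affine)
  where
  go : ∃[ S′ ] S′ ∈ 𝒪 n × S′ ≗ S →
    ℚ.∣ ∑ (restrict S (signed f μ i)) ∣ ℚ.≤ seq (maxOver (𝒪 n) (bias f μ)) i
  go (S′ , S′∈𝒪 , S′≗S) = subst (ℚ._≤ seq (maxOver (𝒪 n) (bias f μ)) i)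
    (trans (seq-bias f μ i S′) (cong ℚ.∣_∣
      (∑-cong λ x → cong (λ b → if b then signed f μ i x else 0ℚ) (S′≗S x))))
    (≤maxOver (bias f μ) i {S′} {𝒪 n} S′∈𝒪)

𝒪⊆𝒮 : ∀ {n} {S : Subset n} → S ∈ 𝒪 n → S ∈ 𝒮 n
𝒪⊆𝒮 {n} S∈𝒪 with ∈-filter⁻ (isAffineOfCodim? 1) {xs = subsets n} S∈𝒪
... | S∈ , codim = ∈-filter⁺ isAffine? {xs = subsets n} S∈ (codim⇒affine codim)

𝒮⇒ternaryClosed : ∀ {n} {S : Subset n} → S ∈ 𝒮 n → TernaryClosed S
𝒮⇒ternaryClosed {n} S∈𝒮 =
  affine⇒ternaryClosed (proj₂ (∈-filter⁻ isAffine? {xs = subsets n} S∈𝒮))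

module _ {n} (f : 𝔽₂^ n → Bool) (μ : 𝔽₂^ n → ℝ) (i : ℕ) where

  ∣charSum∣≤‖F̂‖∞ : ∀ z → ℚ.∣ charSum (signed f μ i) z ∣ ℚ.≤ seq ‖ fourier (signedDensity f μ) ‖∞ i
  ∣charSum∣≤‖F̂‖∞ z = subst (λ p → ℚ.∣ p ∣ ℚ.≤ seq ‖ fourier (signedDensity f μ) ‖∞ i)
    (seq-fourier f μ i z)
    (≤maxOver (λ z → ∣ fourier (signedDensity f μ) z ∣) i {z} {cube n} (cube-complete n z))

  ‖F̂‖∞≤ : ∀ {m} → 0ℚ ℚ.≤ m → (∀ z → ℚ.∣ charSum (signed f μ i) z ∣ ℚ.≤ m) →
    seq ‖ fourier (signedDensity f μ) ‖∞ i ℚ.≤ m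
  ‖F̂‖∞≤ {m} 0≤m h = maxOver≤ (λ z → ∣ fourier (signedDensity f μ) z ∣) i (cube n) 0≤m
    λ {z} _ → subst (λ p → ℚ.∣ p ∣ ℚ.≤ m) (sym (seq-fourier f μ i z)) (h z)

  max𝒪≤max𝒮 : seq (maxOver (𝒪 n) (bias f μ)) i ℚ.≤ seq (maxOver (𝒮 n) (bias f μ)) i
  max𝒪≤max𝒮 = maxOver≤ (bias f μ) i (𝒪 n) (0≤maxOver (bias f μ) i (𝒮 n))
    λ {S} S∈𝒪 → ≤maxOver (bias f μ) i {S} {𝒮 n} (𝒪⊆𝒮 S∈𝒪)

  max𝒮≤‖F̂‖∞ : seq (maxOver (𝒮 n) (bias f μ)) i ℚ.≤ seq ‖ fourier (signedDensity f μ) ‖∞ i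
  max𝒮≤‖F̂‖∞ = maxOver≤ (bias f μ) i (𝒮 n)
    (0≤maxOver (λ z → ∣ fourier (signedDensity f μ) z ∣) i (cube n))
    λ {S} S∈𝒮 → subst (ℚ._≤ seq ‖ fourier (signedDensity f μ) ‖∞ i) (sym (seq-bias f μ i S))
      (∣∑-affine∣≤ S (𝒮⇒ternaryClosed S∈𝒮) (signed f μ i) ∣charSum∣≤‖F̂‖∞)

p+p≡2*p : ∀ p → p ℚ.+ p ≡ (+ 2 ℚ./ 1) ℚ.* p
-- The constant `+ 2 ℚ./ 1` and `1ℚ ℚ.+ 1ℚ` evaluate to the same rational.
p+p≡2*p p = sym (trans (ℚ.*-distribʳ-+ p 1ℚ 1ℚ)
  (cong₂ ℚ._+_ (ℚ.*-identityˡ p) (ℚ.*-identityˡ p)))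

‖F̂‖∞≤2*bound : ∀ {n} → n ℕ.≥ 1 → (f : 𝔽₂^ n → Bool) (μ : 𝔽₂^ n → ℝ) → ∀ i m → 0ℚ ℚ.≤ m →
  (∀ S → IsAffineOfCodim 1 S → ℚ.∣ ∑ (restrict S (signed f μ i)) ∣ ℚ.≤ m) →
  seq ‖ fourier (signedDensity f μ) ‖∞ i ℚ.≤ (+ 2 ℚ./ 1) ℚ.* m
‖F̂‖∞≤2*bound n≥1 f μ i m 0≤m h =
  subst (seq ‖ fourier (signedDensity f μ) ‖∞ i ℚ.≤_) (p+p≡2*p m)
    (‖F̂‖∞≤ f μ i 0≤m+m (∣charSum∣≤ n≥1 (signed f μ i) h))
  where
  0≤m+m : 0ℚ ℚ.≤ m ℚ.+ m
  0≤m+m = ℚ.+-mono-≤ 0≤m 0≤m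

lemma8 : (n : ℕ) → n ℕ.≥ 1 →
    (f : 𝔽₂^ n → Bool) (μ : 𝔽₂^ n → ℝ) → IsProbability μ →
    (maxOver (𝒪 n) (bias f μ) ≤ maxOver (𝒮 n) (bias f μ))
    × (maxOver (𝒮 n) (bias f μ) ≤ ‖ fourier (signedDensity f μ) ‖∞)
    × (‖ fourier (signedDensity f μ) ‖∞ ≤ 2ℝ * maxOver (𝒪 n) (bias f μ))
lemma8 n n≥1 f μ _ =
    pointwise⇒≤ {maxOver (𝒪 n) (bias f μ)} {maxOver (𝒮 n) (bias f μ)} (max𝒪≤max𝒮 f μ)
  , pointwise⇒≤ {maxOver (𝒮 n) (bias f μ)} {‖ fourier (signedDensity f μ) ‖∞} (max𝒮≤‖F̂‖∞ f μ)
  , pointwise⇒≤ {‖ fourier (signedDensity f μ) ‖∞} {2ℝ * maxOver (𝒪 n) (bias f μ)} λ i →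
      ‖F̂‖∞≤2*bound n≥1 f μ i (seq (maxOver (𝒪 n) (bias f μ)) i)
        (0≤maxOver (bias f μ) i (𝒪 n)) (λ S → bias≤maxOver-𝒪 f μ i {S})
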